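{- For any integers $a$ and $n$ with $3 \leq a \leq n-1$, there exists a connected graph $G$ with order $n$, monophonic position number $a$ and diameter $D$ if and only if $2 \leq D \leq n-a+1$.
   Context: All graphs are finite, simple and undirected; the order of a graph is its number of vertices. A monophonic path is an induced (chordless) path. A set $S$ of vertices of a graph $G$ is in monophonic position if no monophonic path of $G$ contains more than two elements of $S$; the monophonic position number of $G$ is the largest size of such a set. -}

module Defs where

open import Data.Fin using (Fin; zero; suc; toℕ; fromℕ; inject₁)
open import Data.Fin.Subset using (Subset; ⁅_⁆; ⋃; _∩_; ∣_∣)
open import Data.List using (tabulate)
open import Data.Nat using (ℕ; suc; _≤_)
open import Data.Product using (∃; ∃₂; _×_)
open import Data.Sum using (_⊎_)
open import Function.Definitions using (Injective)
open import Level using (0ℓ)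
open import Relation.Binary using (Rel; Decidable; Symmetric)
open import Relation.Binary.PropositionalEquality using (_≡_)
open import Relation.Nullary using (¬_)

IsMinimum : (ℕ → Set) → ℕ → Set
IsMinimum P m = P m × (∀ k → P k → m ≤ k)

IsMaximum : (ℕ → Set) → ℕ → Set
IsMaximum P m = P m × (∀ k → P k → k ≤ m)

-- A finite simple graph of order n has vertex set Fin n.  Adjacency is
-- decidable, as is implicit classically for finite graphs.
record Graph (n : ℕ) : Set₁ where
  field
    _~_         : Rel (Fin n) 0ℓ
    ~-decidable : Decidable _~_
    ~-sym       : Symmetric _~_
    ~-loopless  : ∀ v → ¬ (v ~ v)

module _ {n : ℕ} (G : Graph n) where
  open Graph G

  -- A path with k edges, given by its k + 1 pairwise distinct vertices.
  record Path (u v : Fin n) (k : ℕ) : Set where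
    field
      vertex    : Fin (suc k) → Fin n
      injective : Injective _≡_ _≡_ vertex
      adjacent  : ∀ (i : Fin k) → vertex (inject₁ i) ~ vertex (suc i)
      start     : vertex zero ≡ u
      end       : vertex (fromℕ k) ≡ v

    vertexSet : Subset n
    vertexSet = ⋃ (tabulate (λ i → ⁅ vertex i ⁆))

    Monophonic : Set
    Monophonic = ∀ i j → vertex i ~ vertex j →
      toℕ j ≡ suc (toℕ i) ⊎ toℕ i ≡ suc (toℕ j)

  Connected : Set
  Connected = ∀ u v → ∃ λ k → Path u v k

  IsDistance : Fin n → Fin n → ℕ → Set
  IsDistance u v = IsMinimum (Path u v)

  -- Meaningful for connected graphs only: a pair of vertices not joined by
  -- a path has no distance and would be ignored.
  IsDiameter : ℕ → Set
  IsDiameter = IsMaximum (λ d → ∃₂ λ u v → IsDistance u v d)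

  MonophonicPosition : Subset n → Set
  MonophonicPosition S = ∀ {u v k} (p : Path u v k) →
    Path.Monophonic p → ∣ S ∩ Path.vertexSet p ∣ ≤ 2

  IsMonophonicPositionNumber : ℕ → Set
  IsMonophonicPositionNumber =
    IsMaximum (λ k → ∃ λ S → MonophonicPosition S × ∣ S ∣ ≡ k)

{-# OPTIONS --safe #-}
-- Upper bounds: an induced path P on k + 1 vertices meets a set S in monophonic
-- position in at most two vertices, so inclusion–exclusion gives
-- |S| + k + 1 ≤ n + 2.  Applied to a geodesic this bounds the diameter; and D ≥ 2
-- because a graph of diameter at most 1 is complete, hence has all its vertices
-- in monophonic position.
--
-- Existence: write n = j + a and D = e + 2.  Take an induced path on 0, …, j + 1
-- and a clique on the remaining a - 2 vertices, each of which is joined to the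
-- path vertices e, …, j + 1.  The set {j, …, n - 1} is a clique, hence in
-- monophonic position, and the bound above applied to the path shows that it is
-- largest possible.  The distance from j + 1 to 0 is e + 2.
module Submission where

open import Defs
open import Data.Bool using (true; false)
open import Data.Empty using (⊥-elim)
open import Data.Fin using (Fin; zero; suc; toℕ; fromℕ; fromℕ<; inject₁; inject≤)
open import Data.Fin.Properties
  using (any?; toℕ-injective; toℕ<n; toℕ-fromℕ; toℕ-fromℕ<; toℕ-inject₁; toℕ-inject≤; inject≤-injective)
import Data.Fin.Properties as Fin
open import Data.Fin.Subset using (Subset; _∈_; _∉_; _⊆_; ⁅_⁆; ⋃; ⊤; _∪_; _∩_; ∣_∣; outside)
open import Data.Fin.Subset.Properties
  using (_∈?_; ∉⊥; ∣⊤∣≡n; ∣p∣≤n; ∣⁅x⁆∣≡1; x∈⁅x⁆; x∈⁅y⁆⇒x≡y; p⊆q⇒∣p∣≤∣q∣; p⊂q⇒∣p∣<∣q∣;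
         q⊆p∪q; x∈p∪q⁺; x∈p∪q⁻; x∈p∩q⁺; x∈p∩q⁻)
open import Data.List using (tabulate)
open import Data.Nat
  using (ℕ; zero; suc; _≤_; _<_; _+_; _∸_; _⊓_; z≤n; s≤s; s≤s⁻¹; _≟_; _≤?_; _<?_)
open import Data.Nat.Induction using (<-rec)
open import Data.Nat.Properties
  using (≤-refl; ≤-reflexive; ≤-trans; ≤-antisym; ≤-total; ≤-<-trans; <-trans; <-cmp; <-irrefl; <⇒≤;
         <⇒≱; ≰⇒>; ≮⇒≥; ≤∧≢⇒<; n≤1+n; n≮n; suc-injective; +-comm; +-assoc; +-suc; +-identityʳ;
         +-mono-≤; +-monoˡ-≤; +-monoʳ-≤; +-cancelˡ-≤; +-cancelʳ-≤; m≤m+n; m≤n+m; m∸n≤m; m∸n+n≡m;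
         m+[n∸m]≡n; m≥n⇒m⊓n≡n; m⊓n≤n; ⊓-glb; ⊓-monoˡ-≤; ⊓-monoʳ-≤; module ≤-Reasoning)
open import Data.Product using (Σ; ∃; _×_; _,_; proj₁; proj₂)
open import Data.Sum using (_⊎_; inj₁; inj₂; [_,_]′; swap)
open import Data.Vec using ([]; _∷_; there)
open import Function using (_∘_)
open import Function.Bundles using (_⇔_; mk⇔)
open import Relation.Binary using (Tri; tri<; tri≈; tri>)
open import Relation.Binary.PropositionalEquality using (_≡_; _≢_; refl; sym; trans; cong; subst; subst₂)
open import Relation.Nullary using (¬_; Dec; yes; no; contradiction)
open import Relation.Nullary.Decidable using (_⊎-dec_; _×-dec_)

-- Least elements and cardinalities of finite subsets.

private
  variable
    n k l : ℕ

-- `P` need not be decidable, so existence of a minimum is only claimed doubly negated; this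
-- suffices where the goal is a contradiction. If no number were minimal, strong induction would
-- refute `P` everywhere.
minimum-¬¬-exists : ∀ {P : ℕ → Set} → P k → ¬ (∀ m → ¬ IsMinimum P m)
minimum-¬¬-exists {P = P} Pk noMin = noneBelow _ Pk
  where
  noneBelow : ∀ m → ¬ P m
  noneBelow = <-rec (λ m → ¬ P m) λ m none Pm →
    noMin m (Pm , λ l Pl → ≮⇒≥ (λ l<m → none l<m Pl))

∣p∪q∣+∣p∩q∣≡∣p∣+∣q∣ : ∀ (p q : Subset n) → ∣ p ∪ q ∣ + ∣ p ∩ q ∣ ≡ ∣ p ∣ + ∣ q ∣
∣p∪q∣+∣p∩q∣≡∣p∣+∣q∣ []          []          = refl
∣p∪q∣+∣p∩q∣≡∣p∣+∣q∣ (false ∷ p) (false ∷ q) = ∣p∪q∣+∣p∩q∣≡∣p∣+∣q∣ p q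
∣p∪q∣+∣p∩q∣≡∣p∣+∣q∣ (true  ∷ p) (false ∷ q) = cong suc (∣p∪q∣+∣p∩q∣≡∣p∣+∣q∣ p q)
∣p∪q∣+∣p∩q∣≡∣p∣+∣q∣ (false ∷ p) (true  ∷ q) =
  trans (cong suc (∣p∪q∣+∣p∩q∣≡∣p∣+∣q∣ p q)) (sym (+-suc ∣ p ∣ ∣ q ∣))
∣p∪q∣+∣p∩q∣≡∣p∣+∣q∣ (true  ∷ p) (true  ∷ q) = cong suc
  (trans (+-suc ∣ p ∪ q ∣ ∣ p ∩ q ∣)
    (trans (cong suc (∣p∪q∣+∣p∩q∣≡∣p∣+∣q∣ p q)) (sym (+-suc ∣ p ∣ ∣ q ∣))))

∣p∪q∣≤∣p∣+∣q∣ : ∀ (p q : Subset n) → ∣ p ∪ q ∣ ≤ ∣ p ∣ + ∣ q ∣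
∣p∪q∣≤∣p∣+∣q∣ p q = ≤-trans (m≤m+n _ _) (≤-reflexive (∣p∪q∣+∣p∩q∣≡∣p∣+∣q∣ p q))

coveredByTwo : ∀ (p : Subset n) x y → (∀ {z} → z ∈ p → z ≡ x ⊎ z ≡ y) → ∣ p ∣ ≤ 2
coveredByTwo p x y cover = begin
  ∣ p ∣                  ≤⟨ p⊆q⇒∣p∣≤∣q∣ p⊆xy ⟩
  ∣ ⁅ x ⁆ ∪ ⁅ y ⁆ ∣      ≤⟨ ∣p∪q∣≤∣p∣+∣q∣ ⁅ x ⁆ ⁅ y ⁆ ⟩
  ∣ ⁅ x ⁆ ∣ + ∣ ⁅ y ⁆ ∣  ≤⟨ +-mono-≤ (≤-reflexive (∣⁅x⁆∣≡1 x)) (≤-reflexive (∣⁅x⁆∣≡1 y)) ⟩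
  2                      ∎
  where
  open ≤-Reasoning
  p⊆xy : p ⊆ ⁅ x ⁆ ∪ ⁅ y ⁆
  p⊆xy z∈p with cover z∈p
  ... | inj₁ refl = x∈p∪q⁺ (inj₁ (x∈⁅x⁆ x))
  ... | inj₂ refl = x∈p∪q⁺ (inj₂ (x∈⁅x⁆ y))

-- Has the same body as `Path.vertexSet`, so that the lemmas below apply to vertex sets of paths by
-- definitional equality.
image : (Fin k → Fin n) → Subset n
image f = ⋃ (tabulate (λ i → ⁅ f i ⁆))

∈-image⁻ : ∀ (f : Fin k → Fin n) {x} → x ∈ image f → ∃ λ i → x ≡ f i
∈-image⁻ {zero}  f x∈ = contradiction x∈ ∉⊥
∈-image⁻ {suc k} f x∈ with x∈p∪q⁻ ⁅ f zero ⁆ _ x∈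
... | inj₁ x∈f0 = zero , x∈⁅y⁆⇒x≡y _ x∈f0
... | inj₂ x∈f+ with ∈-image⁻ (f ∘ suc) x∈f+
...   | i , x≡fi = suc i , x≡fi

∣image∣≥ : ∀ (f : Fin k → Fin n) → (∀ {i j} → f i ≡ f j → i ≡ j) → k ≤ ∣ image f ∣
∣image∣≥ {zero}  f inj = z≤n
∣image∣≥ {suc k} f inj = ≤-trans
  (s≤s (∣image∣≥ (f ∘ suc) (Fin.suc-injective ∘ inj)))
  (p⊂q⇒∣p∣<∣q∣ (q⊆p∪q ⁅ f zero ⁆ _ , f zero , x∈p∪q⁺ (inj₁ (x∈⁅x⁆ _)) , f0∉))
  where
  f0∉ : f zero ∉ image (f ∘ suc)
  f0∉ f0∈ with ∈-image⁻ (f ∘ suc) f0∈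
  ... | i , eq = Fin.0≢1+n (inj eq)

upper : ∀ j l → Subset (j + l)
upper zero    l = ⊤
upper (suc j) l = outside ∷ upper j l

∣upper∣ : ∀ j l → ∣ upper j l ∣ ≡ l
∣upper∣ zero    l = ∣⊤∣≡n l
∣upper∣ (suc j) l = ∣upper∣ j l

∈upper⇒≥ : ∀ j l {x} → x ∈ upper j l → j ≤ toℕ x
∈upper⇒≥ zero    l _          = z≤n
∈upper⇒≥ (suc j) l (there x∈) = s≤s (∈upper⇒≥ j l x∈)

-- Cliques and induced paths.

module _ {n : ℕ} (G : Graph n) where
  open Graph G
  open Path

  tail : ∀ {u v} (p : Path G u v (suc k)) → Path G (vertex p (suc zero)) v k
  tail p = record
    { vertex    = vertex p ∘ suc
    ; injective = Fin.suc-injective ∘ injective p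
    ; adjacent  = adjacent p ∘ suc
    ; start     = refl
    ; end       = end p
    }

  Clique : Subset n → Set
  Clique S = ∀ {x y} → x ∈ S → y ∈ S → x ≢ y → x ~ y

  -- Clique vertices on an induced path are pairwise adjacent, hence consecutive on it. The
  -- induction discards initial vertices until the path starts in `S`; then only this vertex and its
  -- successor can lie in `S`.
  clique⇒monophonicPosition : ∀ S → Clique S → MonophonicPosition G S
  clique⇒monophonicPosition S clique {k = zero} p _ =
    coveredByTwo (S ∩ vertexSet p) (vertex p zero) (vertex p zero) λ z∈ → inj₁ (only z∈)
    where
    only : ∀ {z} → z ∈ S ∩ vertexSet p → z ≡ vertex p zero
    only z∈ with ∈-image⁻ (vertex p) (proj₂ (x∈p∩q⁻ S _ z∈))
    ... | zero , eq = eq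
  clique⇒monophonicPosition S clique {k = suc k} p mono with vertex p zero ∈? S
  ... | no v0∉S = ≤-trans (p⊆q⇒∣p∣≤∣q∣ drop)
                    (clique⇒monophonicPosition S clique (tail p) monoTail)
    where
    monoTail : Monophonic (tail p)
    monoTail i j i~j with mono (suc i) (suc j) i~j
    ... | inj₁ eq = inj₁ (suc-injective eq)
    ... | inj₂ eq = inj₂ (suc-injective eq)
    drop : S ∩ vertexSet p ⊆ S ∩ vertexSet (tail p)
    drop z∈ with x∈p∩q⁻ S _ z∈
    ... | z∈S , z∈p with x∈p∪q⁻ ⁅ vertex p zero ⁆ _ z∈p
    ...   | inj₁ z∈v0 = contradiction (subst (_∈ S) (x∈⁅y⁆⇒x≡y _ z∈v0) z∈S) v0∉S
    ...   | inj₂ z∈t  = x∈p∩q⁺ (z∈S , z∈t)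
  ... | yes v0∈S = coveredByTwo (S ∩ vertexSet p) (vertex p zero) (vertex p (suc zero)) firstTwo
    where
    firstTwo : ∀ {z} → z ∈ S ∩ vertexSet p → z ≡ vertex p zero ⊎ z ≡ vertex p (suc zero)
    firstTwo z∈ with x∈p∩q⁻ S _ z∈
    ... | z∈S , z∈p with ∈-image⁻ (vertex p) z∈p
    ...   | zero  , eq = inj₁ eq
    ...   | suc i , refl with mono zero (suc i) (clique v0∈S z∈S (Fin.0≢1+n ∘ injective p))
    ...     | inj₁ eq = inj₂ (cong (vertex p) (toℕ-injective eq))

  monophonic-bound : ∀ S {u v} → MonophonicPosition G S → (p : Path G u v k) → Monophonic p →
    ∣ S ∣ + suc k ≤ n + 2
  monophonic-bound {k} S mp p mono = begin
    ∣ S ∣ + suc k                                ≤⟨ +-monoʳ-≤ ∣ S ∣ (∣image∣≥ (vertex p) (injective p)) ⟩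
    ∣ S ∣ + ∣ vertexSet p ∣                      ≡⟨ ∣p∪q∣+∣p∩q∣≡∣p∣+∣q∣ S (vertexSet p) ⟨
    ∣ S ∪ vertexSet p ∣ + ∣ S ∩ vertexSet p ∣    ≤⟨ +-mono-≤ (∣p∣≤n (S ∪ vertexSet p)) (mp p mono) ⟩
    n + 2                                        ∎
    where open ≤-Reasoning

  -- Walks, paths and geodesics.

  -- The index is only an upper bound on the number of edges.
  data Walk : Fin n → Fin n → ℕ → Set where
    nil  : ∀ {u} → Walk u u k
    cons : ∀ {u v w} → u ~ v → Walk v w k → Walk u w (suc k)

  weaken : ∀ {u v} → k ≤ l → Walk u v k → Walk u v l
  weaken _         nil           = nil
  weaken (s≤s k≤l) (cons u~v vw) = cons u~v (weaken k≤l vw)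

  infixr 5 _◅◅_
  _◅◅_ : ∀ {u v w} → Walk u v k → Walk v w l → Walk u w (k + l)
  _◅◅_ {k = k} nil  vw = weaken (m≤n+m _ k) vw
  cons u~v vw ◅◅ wx = cons u~v (vw ◅◅ wx)

  single : ∀ {u v} → u ~ v → Walk u v 1
  single u~v = cons u~v nil

  reverse : ∀ {u v} → Walk u v k → Walk v u k
  reverse nil = nil
  reverse {suc k} (cons u~v vw) =
    subst (Walk _ _) (+-comm k 1) (reverse vw ◅◅ single (~-sym u~v))

  walkBefore : ∀ {u v} (p : Path G u v k) i → Walk u (vertex p i) (toℕ i)
  walkBefore p zero = subst (λ w → Walk w _ 0) (start p) nil
  walkBefore {suc k} p (suc i) = subst (λ w → Walk w _ (suc (toℕ i))) (start p)
    (cons (adjacent p zero) (walkBefore (tail p) i))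

  walkAfter : ∀ {u v} (p : Path G u v k) i → Walk (vertex p i) v (k ∸ toℕ i)
  walkAfter {zero}  p zero    = subst (λ w → Walk _ w 0) (end p) nil
  walkAfter {suc k} p zero    = cons (adjacent p zero) (walkAfter (tail p) zero)
  walkAfter {suc k} p (suc i) = walkAfter (tail p) i

  path⇒walk : ∀ {u v} → Path G u v k → Walk u v k
  path⇒walk p = subst (λ w → Walk w _ _) (start p) (walkAfter p zero)

  Path≤ : Fin n → Fin n → ℕ → Set
  Path≤ u v k = ∃ λ l → l ≤ k × Path G u v l

  suffix : ∀ {u v} (p : Path G u v k) i → Path≤ (vertex p i) v k
  suffix {k} p zero = k , ≤-refl , record
    { vertex = vertex p ; injective = injective p ; adjacent = adjacent p ; start = refl ; end = end p }
  suffix {suc k} p (suc i) with suffix (tail p) i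
  ... | l , l≤k , q = l , ≤-trans l≤k (n≤1+n _) , q

  -- Loop erasure: if the new first vertex already occurs on the path built from the rest, the
  -- suffix starting there is kept; otherwise the vertex is prepended.
  walk⇒path : ∀ {u v} → Walk u v k → Path≤ u v k
  walk⇒path {u = u} nil = 0 , z≤n , record
    { vertex = λ _ → u ; injective = λ { {zero} {zero} _ → refl } ; adjacent = λ () ; start = refl ; end = refl }
  walk⇒path {u = u} (cons u~v vw) with walk⇒path vw
  ... | l , l≤k , p with any? (λ i → vertex p i Fin.≟ u)
  ...   | yes (i , refl) with suffix p i
  ...     | l′ , l′≤l , q = l′ , ≤-trans l′≤l (≤-trans l≤k (n≤1+n _)) , q
  walk⇒path {u = u} (cons u~v vw) | l , l≤k , p | no u∉p = suc l , s≤s l≤k , record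
    { vertex = vertex′ ; injective = injective′ ; adjacent = adjacent′ ; start = refl ; end = end p }
    where
    vertex′ : Fin (suc (suc l)) → Fin n
    vertex′ zero    = u
    vertex′ (suc i) = vertex p i
    injective′ : ∀ {i j} → vertex′ i ≡ vertex′ j → i ≡ j
    injective′ {zero}  {zero}  _  = refl
    injective′ {zero}  {suc j} eq = contradiction (j , sym eq) u∉p
    injective′ {suc i} {zero}  eq = contradiction (i , eq) u∉p
    injective′ {suc i} {suc j} eq = cong suc (injective p eq)
    adjacent′ : ∀ i → vertex′ (inject₁ i) ~ vertex′ (suc i)
    adjacent′ zero    = subst (u ~_) (sym (start p)) u~v
    adjacent′ (suc i) = adjacent p i

  distance≤walk : ∀ {u v d} → IsDistance G u v d → Walk u v k → d ≤ k
  distance≤walk (_ , minimal) w with walk⇒path w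
  ... | l , l≤k , p = ≤-trans (minimal l p) l≤k

  -- A chord would replace a segment of at least two edges by a single edge, contradicting
  -- minimality.
  geodesic⇒monophonic : ∀ {u v} (p : Path G u v k) → (∀ l → Path G u v l → k ≤ l) → Monophonic p
  geodesic⇒monophonic {k} p minimal i j i~j = consecutive (<-cmp (toℕ i) (toℕ j))
    where
    open ≤-Reasoning
    noShortcut : ∀ i j → vertex p i ~ vertex p j → toℕ j ≤ suc (toℕ i)
    -- The detour follows `p` up to `i`, crosses the chord and follows `p` from `j`. It is only a
    -- walk, but loop erasure extends the minimality of `k` to walks.
    noShortcut i j i~j = +-cancelˡ-≤ (k ∸ toℕ j) _ _ (begin
      k ∸ toℕ j + toℕ j          ≡⟨ m∸n+n≡m (s≤s⁻¹ (toℕ<n j)) ⟩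
      k                          ≤⟨ distance≤walk (p , minimal) (walkBefore p i ◅◅ cons i~j (walkAfter p j)) ⟩
      toℕ i + suc (k ∸ toℕ j)    ≡⟨ +-suc (toℕ i) _ ⟩
      suc (toℕ i) + (k ∸ toℕ j)  ≡⟨ +-comm (suc (toℕ i)) _ ⟩
      k ∸ toℕ j + suc (toℕ i)    ∎)
    consecutive : Tri (toℕ i < toℕ j) (toℕ i ≡ toℕ j) (toℕ j < toℕ i) →
      toℕ j ≡ suc (toℕ i) ⊎ toℕ i ≡ suc (toℕ j)
    consecutive (tri< i<j _ _) = inj₁ (≤-antisym (noShortcut i j i~j) i<j)
    consecutive (tri≈ _ i≡j _) =
      contradiction (subst (λ i → vertex p i ~ vertex p j) (toℕ-injective i≡j) i~j) (~-loopless _)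
    consecutive (tri> _ _ j<i) = inj₂ (≤-antisym (noShortcut j i (~-sym i~j)) j<i)

  -- A device for bounding distances from below: a potential that falls by at most one along each
  -- edge.
  potential-bound : ∀ (φ : Fin n → ℕ) → (∀ {x y} → x ~ y → φ x ≤ suc (φ y)) →
    ∀ {u v} → Walk u v k → φ u ≤ k + φ v
  potential-bound {k} φ lip nil = m≤n+m _ k
  potential-bound φ lip (cons u~v vw) = ≤-trans (lip u~v) (s≤s (potential-bound φ lip vw))

  -- Since adjacency is decidable, only the non-adjacent case needs an argument. There the goal is
  -- absurd, so the doubly negated existence of a distance is enough: a path with at most one edge
  -- forces equality or adjacency.
  diameter≤1⇒complete : ∀ {D} → Connected G → IsDiameter G D → D ≤ 1 → ∀ {u v} → u ≢ v → u ~ v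
  diameter≤1⇒complete conn (_ , bound) D≤1 {u} {v} u≢v with ~-decidable u v
  ... | yes u~v = u~v
  ... | no ¬u~v = ⊥-elim (minimum-¬¬-exists (proj₂ (conn u v)) λ d dist →
          short (≤-trans (bound d (u , v , dist)) D≤1) (proj₁ dist))
    where
    short : ∀ {d} → d ≤ 1 → ¬ Path G u v d
    short {zero}        _ p = u≢v (trans (sym (start p)) (end p))
    short {suc zero}    _ p = ¬u~v (subst₂ _~_ (start p) (end p) (adjacent p zero))
    short {suc (suc _)} (s≤s ()) p

  diameter≥2 : ∀ {a D} → Connected G → IsMonophonicPositionNumber G a → IsDiameter G D →
    a < n → 2 ≤ D
  diameter≥2 {D = D} conn (_ , maximal) diam a<n with D ≤? 1
  ... | no D≰1  = ≰⇒> D≰1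
  ... | yes D≤1 = contradiction
    (maximal n (⊤ , clique⇒monophonicPosition ⊤ (λ _ _ → diameter≤1⇒complete conn diam D≤1) , ∣⊤∣≡n n))
    (<⇒≱ a<n)

  mpNumber+diameter≤ : ∀ {a D} → IsMonophonicPositionNumber G a → IsDiameter G D → a + suc D ≤ n + 2
  mpNumber+diameter≤ ((S , mp , refl) , _) ((_ , _ , p , minimal) , _) =
    monophonic-bound S mp p (geodesic⇒monophonic p minimal)

-- A graph with prescribed order, position number and diameter.

module Construction (j c e : ℕ) (e<j : e < j) where

  -- The form `3 + c` guarantees a vertex numbered `2 + j` beyond the path. With diameter `2 + e`,
  -- the hypothesis `e < j` is the bound `D ≤ n - a + 1`.
  a order : ℕ
  a     = 3 + c
  order = j + a

  2+j<order : 2 + j < order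
  2+j<order = ≤-trans (≤-reflexive (+-comm 3 j)) (+-monoʳ-≤ j (m≤m+n 3 c))

  1+j<order : 1 + j < order
  1+j<order = <⇒≤ 2+j<order

  0<order : 0 < order
  0<order = ≤-trans (s≤s z≤n) 1+j<order

  e<order : e < order
  e<order = ≤-trans e<j (m≤m+n j a)

  -- Edges are oriented towards the larger number. The second alternative yields both the edges
  -- inside the added clique and those joining it to the path; it may overlap with the first.
  Arc : ℕ → ℕ → Set
  Arc x y = y ≡ suc x ⊎ (x < y × 2 + j ≤ y × e ≤ x)

  arc⇒< : ∀ {x y} → Arc x y → x < y
  arc⇒< (inj₁ refl)      = ≤-refl
  arc⇒< (inj₂ (x<y , _)) = x<y

  arc? : ∀ x y → Dec (Arc x y)
  arc? x y = (y ≟ suc x) ⊎-dec (x <? y ×-dec 2 + j ≤? y ×-dec e ≤? x)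

  G : Graph order
  G = record
    { _~_         = λ u v → Arc (toℕ u) (toℕ v) ⊎ Arc (toℕ v) (toℕ u)
    ; ~-decidable = λ u v → arc? (toℕ u) (toℕ v) ⊎-dec arc? (toℕ v) (toℕ u)
    ; ~-sym       = swap
    ; ~-loopless  = λ v → [ <-irrefl refl ∘ arc⇒< , <-irrefl refl ∘ arc⇒< ]′
    }
  open Graph G

  -- Of two distinct numbers from `j` on, the larger is the successor of the smaller or at least
  -- `2 + j`.
  arc : ∀ {x y} → j ≤ x → x < y → Arc x y
  arc {x} {y} j≤x x<y with y ≟ suc x
  ... | yes y≡1+x = inj₁ y≡1+x
  ... | no  y≢1+x = inj₂ (x<y , ≤-trans (s≤s (s≤s j≤x)) (≤∧≢⇒< x<y (y≢1+x ∘ sym)) , ≤-trans (<⇒≤ e<j) j≤x)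

  upper-clique : Clique G (upper j a)
  upper-clique {x} {y} x∈ y∈ x≢y with <-cmp (toℕ x) (toℕ y)
  ... | tri< x<y _ _ = inj₁ (arc (∈upper⇒≥ j a x∈) x<y)
  ... | tri≈ _ x≡y _ = contradiction (toℕ-injective x≡y) x≢y
  ... | tri> _ _ y<x = inj₂ (arc (∈upper⇒≥ j a y∈) y<x)

  path : Path G (fromℕ< 0<order) (fromℕ< 1+j<order) (suc j)
  path = record
    { vertex    = λ i → inject≤ i 1+j<order
    ; injective = inject≤-injective _ _ _ _
    ; adjacent  = λ i → inj₁ (inj₁ (trans (toℕ-inject≤ (suc i) _)
        (cong suc (sym (trans (toℕ-inject≤ (inject₁ i) _) (toℕ-inject₁ i))))))
    ; start     = toℕ-injective (trans (toℕ-inject≤ zero 1+j<order) (sym (toℕ-fromℕ< 0<order)))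
    ; end       = toℕ-injective
        (trans (toℕ-inject≤ (fromℕ (suc j)) _) (trans (toℕ-fromℕ (suc j)) (sym (toℕ-fromℕ< 1+j<order))))
    }

  -- An arc between non-consecutive numbers ends at `2 + j` or later, which is beyond the path.
  path-monophonic : Path.Monophonic path
  path-monophonic i i′ rewrite toℕ-inject≤ i 1+j<order | toℕ-inject≤ i′ 1+j<order =
    [ inj₁ ∘ consecutive (toℕ<n i′) , inj₂ ∘ consecutive (toℕ<n i) ]′
    where
    consecutive : ∀ {x y} → y < 2 + j → Arc x y → y ≡ suc x
    consecutive _     (inj₁ y≡1+x)           = y≡1+x
    consecutive y<2+j (inj₂ (_ , 2+j≤y , _)) = contradiction 2+j≤y (<⇒≱ y<2+j)

  mpNumber : IsMonophonicPositionNumber G a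
  mpNumber = (upper j a , clique⇒monophonicPosition G _ upper-clique , ∣upper∣ j a) ,
    λ { _ (S , mp , refl) → +-cancelʳ-≤ (2 + j) _ _ (begin
      ∣ S ∣ + (2 + j)  ≤⟨ monophonic-bound G S mp path path-monophonic ⟩
      j + a + 2        ≡⟨ cong (_+ 2) (+-comm j a) ⟩
      a + j + 2        ≡⟨ +-assoc a j 2 ⟩
      a + (j + 2)      ≡⟨ cong (a +_) (+-comm j 2) ⟩
      a + (2 + j)      ∎) }
    where open ≤-Reasoning

  -- Distances in the constructed graph.

  line : ∀ d {u v} → toℕ v ≡ d + toℕ u → Walk G u v d
  line zero    v≡u = subst (λ w → Walk G _ w 0) (sym (toℕ-injective v≡u)) nil
  line (suc d) {u} {v} v≡1+d+u =
    cons (inj₁ (inj₁ (toℕ-fromℕ< 1+u<order)))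
      (line d (trans v≡1+d+u (sym (trans (cong (d +_) (toℕ-fromℕ< 1+u<order)) (+-suc d _)))))
    where
    1+u<order : suc (toℕ u) < order
    1+u<order = ≤-<-trans (≤-trans (s≤s (m≤n+m (toℕ u) d)) (≤-reflexive (sym v≡1+d+u))) (toℕ<n v)

  -- The first vertex off the path; it is adjacent to every other vertex numbered from `e` on, so
  -- short walks are routed through it.
  hub : Fin order
  hub = fromℕ< 2+j<order

  toℕ-hub : toℕ hub ≡ 2 + j
  toℕ-hub = toℕ-fromℕ< 2+j<order

  e≤hub : e ≤ toℕ hub
  e≤hub = ≤-trans (<⇒≤ e<j) (≤-trans (m≤n+m j 2) (≤-reflexive (sym toℕ-hub)))

  near-hub : ∀ {u} → e ≤ toℕ u → Walk G u hub 1
  near-hub {u} e≤u with <-cmp (toℕ u) (toℕ hub)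
  ... | tri< u<h _ _ = single G (inj₁ (inj₂ (u<h , ≤-reflexive (sym toℕ-hub) , e≤u)))
  ... | tri≈ _ u≡h _ = subst (λ w → Walk G u w 1) (toℕ-injective u≡h) nil
  ... | tri> _ _ h<u = single G
    (inj₂ (inj₂ (h<u , ≤-trans (≤-reflexive (sym toℕ-hub)) (<⇒≤ h<u) , e≤hub)))

  to-hub : ∀ u → Walk G u hub (e + 1)
  to-hub u with e ≤? toℕ u
  ... | yes e≤u = weaken G (m≤n+m 1 e) (near-hub e≤u)
  ... | no  e≰u = weaken G (+-monoˡ-≤ 1 (m∸n≤m e (toℕ u)))
    (_◅◅_ G (line (e ∸ toℕ u) (trans toℕ-ε (sym (m∸n+n≡m (<⇒≤ (≰⇒> e≰u))))))
            (near-hub (≤-reflexive (sym toℕ-ε))))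
    where
    toℕ-ε : toℕ (fromℕ< e<order) ≡ e
    toℕ-ε = toℕ-fromℕ< e<order

  -- By symmetry let `v` have the larger number. If it is at least `e`, going from `u` to the hub
  -- and on to `v` costs at most `(e + 1) + 1`. Otherwise both lie below `e`, and the path itself is
  -- short enough.
  close : ∀ u v → Walk G u v (2 + e)
  close u v = [ ascending , reverse G ∘ ascending ]′ (≤-total (toℕ u) (toℕ v))
    where
    ascending : ∀ {u v} → toℕ u ≤ toℕ v → Walk G u v (2 + e)
    ascending {u} {v} u≤v with e ≤? toℕ v
    ... | yes e≤v = subst (Walk G u v) (trans (+-assoc e 1 1) (+-comm e 2))
                      (_◅◅_ G (to-hub u) (reverse G (near-hub e≤v)))
    ... | no  e≰v = weaken G
                      (≤-trans (m∸n≤m (toℕ v) (toℕ u)) (≤-trans (<⇒≤ (≰⇒> e≰v)) (m≤n+m e 2)))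
                      (line (toℕ v ∸ toℕ u) (sym (m∸n+n≡m u≤v)))

  connected : Connected G
  connected u v with walk⇒path G (close u v)
  ... | k , _ , p = k , p

  -- The distance from the vertex 0, truncated at suc e.
  φ : Fin order → ℕ
  φ u = toℕ u ⊓ suc e

  -- Both ends of a non-consecutive edge are numbered at least `e`, where truncation leaves only the
  -- values `e` and `suc e`.
  φ-lipschitz : ∀ {u v} → u ~ v → φ u ≤ suc (φ v)
  φ-lipschitz (inj₁ arc) = ≤-trans (⊓-monoˡ-≤ (suc e) (<⇒≤ (arc⇒< arc))) (n≤1+n _)
  φ-lipschitz {u} {v} (inj₂ (inj₁ u≡1+v)) rewrite u≡1+v = s≤s (⊓-monoʳ-≤ (toℕ v) (n≤1+n e))
  φ-lipschitz {u} {v} (inj₂ (inj₂ (_ , _ , e≤v))) =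
    ≤-trans (m⊓n≤n (toℕ u) (suc e)) (s≤s (⊓-glb e≤v (n≤1+n e)))

  -- The truncated potential alone gives only `suc e`. The missing unit is the first step: every
  -- neighbour of `suc j` is larger or equals `j`, so it is still numbered above `e` and has full
  -- potential.
  far : ∀ {u v} → toℕ u ≡ suc j → toℕ v ≡ 0 → Walk G u v k → 2 + e ≤ k
  far u≡1+j v≡0 nil = contradiction (trans (sym v≡0) u≡1+j) λ ()
  far {suc k} u≡1+j v≡0 (cons {v = w} u~w wv) = s≤s (begin
    suc e       ≡⟨ m≥n⇒m⊓n≡n (e<neighbour u≡1+j u~w) ⟨
    φ w         ≤⟨ potential-bound G φ φ-lipschitz wv ⟩
    k + φ _     ≡⟨ cong (λ x → k + (x ⊓ suc e)) v≡0 ⟩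
    k + 0       ≡⟨ +-identityʳ k ⟩
    k           ∎)
    where
    open ≤-Reasoning
    e<neighbour : ∀ {u w} → toℕ u ≡ suc j → u ~ w → e < toℕ w
    e<neighbour u≡ (inj₁ arc) =
      <-trans (≤-trans e<j (≤-trans (n≤1+n j) (≤-reflexive (sym u≡)))) (arc⇒< arc)
    e<neighbour u≡ (inj₂ (inj₁ u≡1+w)) =
      subst (e <_) (suc-injective (trans (sym u≡) u≡1+w)) e<j
    e<neighbour u≡ (inj₂ (inj₂ (_ , 2+j≤u , _))) =
      contradiction (≤-trans 2+j≤u (≤-reflexive u≡)) (n≮n _)

  diameter : IsDiameter G (2 + e)
  diameter = (top , bottom , geodesic , λ k p → lower (path⇒walk G p)) ,
    λ { d (u , v , dist) → distance≤walk G dist (close u v) }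
    where
    top bottom : Fin order
    top    = fromℕ< 1+j<order
    bottom = fromℕ< 0<order
    lower : Walk G top bottom k → 2 + e ≤ k
    lower = far (toℕ-fromℕ< 1+j<order) (toℕ-fromℕ< 0<order)
    geodesic : Path G top bottom (2 + e)
    -- Loop erasure yields at most `2 + e` edges, and the lower bound makes this exact.
    geodesic with walk⇒path G (close top bottom)
    ... | l , l≤2+e , p = subst (Path G top bottom) (≤-antisym l≤2+e (lower (path⇒walk G p))) p

theorem4p1 : (a n : ℕ) → 3 ≤ a → a ≤ n ∸ 1 → (D : ℕ) →
    (Σ (Graph n) λ G → Connected G × IsMonophonicPositionNumber G a × IsDiameter G D)
    ⇔ (2 ≤ D × D ≤ n ∸ a + 1)
-- Truncated subtraction gives `0 ∸ 1 = 0`, so order zero contradicts `3 ≤ a`.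
theorem4p1 a zero    3≤a a≤n-1 D = contradiction (≤-trans 3≤a a≤n-1) λ ()
theorem4p1 a (suc m) 3≤a a≤m   D = mk⇔ necessary (sufficient 3≤a)
  where
  open ≤-Reasoning
  a≤1+m : a ≤ suc m
  a≤1+m = ≤-trans a≤m (n≤1+n m)
  Realizable : ℕ → Set₁
  Realizable n = Σ (Graph n) λ G → Connected G × IsMonophonicPositionNumber G a × IsDiameter G D
  necessary : Realizable (suc m) → 2 ≤ D × D ≤ suc m ∸ a + 1
  necessary (G , conn , mp , diam) =
    diameter≥2 G conn mp diam (s≤s a≤m) , s≤s⁻¹ (+-cancelˡ-≤ a _ _ (begin
      a + suc D                  ≤⟨ mpNumber+diameter≤ G mp diam ⟩
      suc m + 2                  ≡⟨ cong (_+ 2) (m+[n∸m]≡n a≤1+m) ⟨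
      a + (suc m ∸ a) + 2        ≡⟨ +-assoc a (suc m ∸ a) 2 ⟩
      a + (suc m ∸ a + 2)        ≡⟨ cong (a +_) (+-suc (suc m ∸ a) 1) ⟩
      a + suc (suc m ∸ a + 1)    ∎))
  sufficient : 3 ≤ a → 2 ≤ D × D ≤ suc m ∸ a + 1 → Realizable (suc m)
  -- The patterns read off `a = 3 + c` and `D = 2 + e`. The construction with `j = suc m ∸ a` has
  -- order `(suc m ∸ a) + a`, which is transported to `suc m`.
  sufficient (s≤s (s≤s (s≤s {n = c} _))) (s≤s (s≤s {n = e} _) , D≤) =
    subst Realizable (m∸n+n≡m a≤1+m) (C.G , C.connected , C.mpNumber , C.diameter)
    where
    module C = Construction (suc m ∸ a) c e (s≤s⁻¹ (≤-trans D≤ (≤-reflexive (+-comm (suc m ∸ a) 1))))
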